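{- Let $\Delta \ge 7$ be an integer. Every $\Delta$-regular graph $G$ satisfies $\gamma(G) \le \gamma_e(G)$.
   Context: Graphs are finite, simple and undirected. A graph is $\Delta$-regular if every vertex has exactly $\Delta$ neighbours. A dominating set of $G$ is a set $S$ of vertices such that every vertex outside $S$ has a neighbour in $S$; the domination number $\gamma(G)$ is the minimum size of a dominating set. A matching is a set of edges no two of which share a vertex; it is maximal if no edge of $G$ can be added to it. The edge domination number $\gamma_e(G)$ is the minimum size of a maximal matching of $G$. -}

module Defs where

open import Data.Fin.Base using (Fin; _<_)
open import Data.Fin.Properties using (_≟_; _<?_; all?; any?)
open import Data.Fin.Subset using (Subset; _∈_; _∉_; _∪_; ⁅_⁆; ⊤; ⊥; ∣_∣; _⊃_)
open import Data.Fin.Subset.Induction using (⊃-wellFounded)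
open import Data.Fin.Subset.Properties
  using (_∈?_; anySubset?; ∈⊤; ∉⊥; p⊆p∪q; q⊆p∪q; x∈⁅x⁆)
open import Data.List.Base
  using (List; length; lookup; filter; allFin; cartesianProduct)
open import Data.List.Membership.Propositional using () renaming (_∈_ to _∈ˡ_)
open import Data.List.Membership.Propositional.Properties
  using (∈-filter⁺; ∈-filter⁻; ∈-cartesianProduct⁺; ∈-allFin)
open import Data.List.Relation.Unary.Unique.Propositional using (Unique)
import Data.List.Relation.Unary.Unique.Propositional.Properties as Unique
open import Data.Nat.Base as ℕ using (ℕ; _≤_)
import Data.Nat.Induction as ℕ
import Data.Nat.Properties as ℕ
open import Data.Product.Base using (∃; _×_; _,_; proj₁; proj₂; uncurry)
open import Data.Sum.Base using (_⊎_)
open import Data.Vec.Base using (tabulate)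
open import Function.Bundles using (_⇔_; mk⇔)
open import Induction.WellFounded using (Acc; acc)
open import Level using (0ℓ)
open import Relation.Binary.Core using (Rel)
open import Relation.Binary.Definitions using (Symmetric; Irreflexive)
  renaming (Decidable to Decidable₂)
open import Relation.Binary.PropositionalEquality using (_≡_; _≢_; refl)
open import Relation.Nullary.Decidable
  using (yes; no; does; ¬?; _×-dec_; _⊎-dec_; _→-dec_)
open import Relation.Nullary.Negation using (¬_; contradiction)
open import Relation.Unary using (Pred; Decidable)

record IsMinimumSize {k : ℕ} (P : Pred (Subset k) 0ℓ) (m : ℕ) : Set where
  field
    attained   : ∃ λ S → P S × ∣ S ∣ ≡ m
    lowerBound : ∀ S → P S → m ≤ ∣ S ∣

minimumSize : ∀ {k} {P : Pred (Subset k) 0ℓ} → Decidable P → ∃ P →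
              ∃ (IsMinimumSize P)
minimumSize {k} {P} P? (S , PS) = go S PS (ℕ.<-wellFounded ∣ S ∣)
  where
  go : ∀ S → P S → Acc ℕ._<_ ∣ S ∣ → ∃ (IsMinimumSize P)
  go S PS (acc rs) with anySubset? (λ T → P? T ×-dec (∣ T ∣ ℕ.<? ∣ S ∣))
  ... | yes (T , PT , T<S) = go T PT (rs T<S)
  ... | no ∄T = ∣ S ∣ , record
    { attained   = S , PS , refl
    ; lowerBound = λ T PT → ℕ.≮⇒≥ λ T<S → ∄T (T , PT , T<S)
    }

record Graph (n : ℕ) : Set₁ where
  infix 4 _~_ _~?_
  field
    _~_      : Rel (Fin n) 0ℓ
    _~?_     : Decidable₂ _~_
    ~-sym    : Symmetric _~_
    ~-irrefl : Irreflexive _≡_ _~_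

module _ {n : ℕ} (G : Graph n) where
  open Graph G

  neighbours : Fin n → Subset n
  neighbours v = tabulate λ u → does (v ~? u)

  Regular : ℕ → Set
  Regular Δ = ∀ v → ∣ neighbours v ∣ ≡ Δ

  Dominating : Pred (Subset n) 0ℓ
  Dominating S = ∀ v → v ∉ S → ∃ λ u → u ∈ S × v ~ u

  dominating? : Decidable Dominating
  dominating? S = all? λ v →
    ¬? (v ∈? S) →-dec any? λ u → (u ∈? S) ×-dec (v ~? u)

  dominationNumber : ∃ (IsMinimumSize Dominating)
  dominationNumber =
    minimumSize dominating? (⊤ , λ v v∉⊤ → contradiction ∈⊤ v∉⊤)

  γ : ℕ
  γ = proj₁ dominationNumber

  -- Each edge {u , v} is listed once, as the pair with u < v.
  isEdge? : Decidable (uncurry λ u v → u < v × u ~ v)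
  isEdge? (u , v) = (u <? v) ×-dec (u ~? v)

  edges : List (Fin n × Fin n)
  edges = filter isEdge? (cartesianProduct (allFin n) (allFin n))

  ∈-edges : ∀ {u v} → (u , v) ∈ˡ edges ⇔ (u < v × u ~ v)
  ∈-edges {u} {v} = mk⇔
    (λ uv∈ → proj₂ (∈-filter⁻ isEdge? {xs = cartesianProduct (allFin n) (allFin n)} uv∈))
    (∈-filter⁺ isEdge? (∈-cartesianProduct⁺ (∈-allFin u) (∈-allFin v)))

  edges-unique : Unique edges
  edges-unique = Unique.filter⁺ isEdge?
    (Unique.cartesianProduct⁺ (Unique.allFin⁺ n) (Unique.allFin⁺ n))

  -- Edges are named by their position in the list, so that a set of edges
  -- is a Subset (length edges).
  Edge : Set
  Edge = Fin (length edges)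

  EdgeSet : Set
  EdgeSet = Subset (length edges)

  Incident : Fin n → Edge → Set
  Incident v e = v ≡ proj₁ (lookup edges e) ⊎ v ≡ proj₂ (lookup edges e)

  ShareVertex : Edge → Edge → Set
  ShareVertex e f = ∃ λ v → Incident v e × Incident v f

  Matching : Pred EdgeSet 0ℓ
  Matching M = ∀ e f → e ∈ M → f ∈ M → e ≢ f → ¬ ShareVertex e f

  MaximalMatching : Pred EdgeSet 0ℓ
  MaximalMatching M = Matching M × (∀ e → e ∉ M → ¬ Matching (M ∪ ⁅ e ⁆))

  incident? : Decidable₂ Incident
  incident? v e = (v ≟ proj₁ (lookup edges e)) ⊎-dec (v ≟ proj₂ (lookup edges e))

  shareVertex? : Decidable₂ ShareVertex
  shareVertex? e f = any? λ v → incident? v e ×-dec incident? v f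

  matching? : Decidable Matching
  matching? M = all? λ e → all? λ f →
    (e ∈? M) →-dec ((f ∈? M) →-dec (¬? (e ≟ f) →-dec ¬? (shareVertex? e f)))

  maximalMatching? : Decidable MaximalMatching
  maximalMatching? M = matching? M ×-dec
    all? λ e → ¬? (e ∈? M) →-dec ¬? (matching? (M ∪ ⁅ e ⁆))

  maximalMatching-exists : ∃ MaximalMatching
  maximalMatching-exists =
    extend ⊥ (λ _ _ e∈⊥ → contradiction e∈⊥ ∉⊥) (⊃-wellFounded ⊥)
    where
    extend : ∀ M → Matching M → Acc _⊃_ M → ∃ MaximalMatching
    extend M mM (acc rs)
      with any? (λ e → ¬? (e ∈? M) ×-dec matching? (M ∪ ⁅ e ⁆))
    ... | no ∄e = M , mM , λ e e∉M m → ∄e (e , e∉M , m)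
    ... | yes (e , e∉M , m) = extend (M ∪ ⁅ e ⁆) m
      (rs (p⊆p∪q ⁅ e ⁆ , e , q⊆p∪q M ⁅ e ⁆ (x∈⁅x⁆ e) , e∉M))

  edgeDominationNumber : ∃ (IsMinimumSize MaximalMatching)
  edgeDominationNumber = minimumSize maximalMatching? maximalMatching-exists

  γₑ : ℕ
  γₑ = proj₁ edgeDominationNumber

module Submission where

-- Let M be a minimum maximal matching and pick one endpoint of every edge of M
-- uniformly at random. Covered vertices are dominated, and an uncovered vertex
-- is undominated with probability at most 2^-Δ, as its neighbours are all
-- covered. Two such events need to be treated as dependent only if they ask for
-- opposite endpoints of a common edge, so each of them conflicts with at most
-- Δ (Δ - 1) others. The lopsided local lemma, carried out by counting the
-- selections, provides a selection that dominates every vertex once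
-- (d + 1)^(d + 1) ≤ 2^Δ d^d for d = Δ (Δ - 1); Δ = 7 is the least such degree.

open import Algebra.Properties.CommutativeSemigroup using (interchange)
open import Data.Bool.Base using (Bool; true; false; not; if_then_else_)
open import Data.Bool.Properties using (¬-not; not-¬) renaming (_≟_ to _≟ᵇ_)
open import Data.Fin.Base using (Fin; zero; suc)
open import Data.Fin.Properties using (_≟_; <-cmp; all?; any?)
open import Data.Fin.Subset
  using (Subset; _∈_; _∉_; _∪_; _⊆_; ∣_∣; ⁅_⁆; ⊥; ⋃; _-_)
open import Data.Fin.Subset.Properties
  using (_∈?_; anySubset?; ∣⊥∣≡0; ∣⁅x⁆∣≡1; x∈⁅x⁆; x∈⁅y⁆⇒x≡y; ∣p∣≤∣x∷p∣; p⊆p∪q;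
         q⊆p∪q; x∈p∪q⁻; p⊆q⇒∣p∣≤∣q∣; x∈p∧x≢y⇒x∈p-y; x∈p⇒∣p-x∣<∣p∣)
open import Data.List.Base as List
  using (List; []; _∷_; _++_; length; map; filter; allFin; partition; take)
open import Data.List.Membership.Propositional using () renaming (_∈_ to _∈ˡ_)
open import Data.List.Membership.Propositional.Properties
  using (∈-allFin; ∈-++⁺ˡ; ∈-filter⁺; ∈-lookup)
open import Data.List.Properties using (++-identityʳ; length-take)
open import Data.List.Relation.Binary.Permutation.Propositional
  using (_↭_; ↭⇒↭ₛ; ↭ₛ⇒↭; ↭-sym)
open import Data.List.Relation.Binary.Permutation.Propositional.Properties
  using (All-resp-↭; ↭-length)
import Data.List.Relation.Binary.Permutation.Setoid.Properties as ↭ₛ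
open import Data.List.Relation.Unary.All as All using (All; []; _∷_)
open import Data.List.Relation.Unary.All.Properties
  using (partition-All; all-filter; take⁺; ++⁻ˡ; ++⁻ʳ)
open import Data.List.Relation.Unary.AllPairs using ([]; _∷_)
open import Data.List.Relation.Unary.Any using (here; there; index)
open import Data.List.Relation.Unary.Any.Properties using (lookup-index)
open import Data.List.Relation.Unary.Unique.Propositional using (Unique)
import Data.List.Relation.Unary.Unique.Propositional.Properties as Unique
open import Data.Nat.Base
  using (ℕ; zero; suc; _+_; _*_; _^_; _∸_; _≤_; _<_; z≤n; s≤s; NonZero;
         ≤‴-refl; ≤‴-step)
open import Data.Nat.Properties hiding (_≟_; <-cmp)
open import Data.Nat.Tactic.RingSolver using (solve-∀)
open import Data.Product.Base using (∃; _×_; _,_; proj₁; proj₂)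
open import Data.Sum.Base as Sum using (_⊎_; inj₁; inj₂)
open import Data.Unit.Base using (tt)
open import Data.Vec.Base using (Vec; []; _∷_; lookup; updateAt)
open import Data.Vec.Properties
  using (lookup∘updateAt; lookup∘updateAt′; lookup∘tabulate; lookup⇒[]=; []=⇒lookup)
open import Defs
open import Function.Base using (_∘_)
open import Function.Bundles using (module Equivalence)
open import Level using (0ℓ)
open import Relation.Binary.Definitions using (tri<; tri≈; tri>)
open import Relation.Binary.PropositionalEquality
  using (_≡_; _≢_; refl; sym; trans; cong; cong₂; subst; setoid)
open import Relation.Nullary.Decidable
  using (yes; no; does; ¬?; _×-dec_; _→-dec_; dec-true; decidable-stable; toWitness)
open import Relation.Nullary.Negation using (¬_; contradiction)
open import Relation.Unary using (Pred; Decidable; _∩_)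
open import Relation.Unary.Properties using (_∩?_; ∁?)

-- Counting Boolean assignments

private variable
  m n : ℕ
  P Q : Pred (Vec Bool m) 0ℓ

-- Divided by `2 ^ m` this is a probability under uniform selection; bounds on conditional
-- probabilities become inequalities between two such counts.
# : {P : Pred (Vec Bool m) 0ℓ} → Decidable P → ℕ
# {zero}  P? = if does (P? []) then 1 else 0
# {suc m} P? = # (P? ∘ (true ∷_)) + # (P? ∘ (false ∷_))

#-mono : (P? : Decidable P) (Q? : Decidable Q) → (∀ {σ} → P σ → Q σ) → # P? ≤ # Q?
#-mono {zero}  P? Q? P⊆Q with P? [] | Q? []
... | no _  | _      = z≤n
... | yes p | yes _  = ≤-refl
... | yes p | no ¬q  = contradiction (P⊆Q p) ¬q
#-mono {suc m} P? Q? P⊆Q =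
  +-mono-≤ (#-mono (P? ∘ (true ∷_)) (Q? ∘ (true ∷_)) P⊆Q)
           (#-mono (P? ∘ (false ∷_)) (Q? ∘ (false ∷_)) P⊆Q)

#-split : (P? : Decidable P) (Q? : Decidable Q) →
          # P? ≡ # (P? ∩? Q?) + # (P? ∩? ∁? Q?)
#-split {zero}  P? Q? with P? [] | Q? []
... | no _  | _     = refl
... | yes _ | yes _ = refl
... | yes _ | no _  = refl
#-split {suc m} P? Q? = trans
  (cong₂ _+_ (#-split (P? ∘ (true ∷_)) (Q? ∘ (true ∷_)))
             (#-split (P? ∘ (false ∷_)) (Q? ∘ (false ∷_))))
  (interchange +-commutativeSemigroup (# ((P? ∩? Q?) ∘ (true ∷_))) _ _ _)

#-satisfiable : (P? : Decidable P) → 0 < # P? → ∃ P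
#-satisfiable {zero}  P? 0<# with P? []
... | yes p = [] , p
#-satisfiable {suc m} P? 0<# with # (P? ∘ (true ∷_)) in eq
... | zero  = let σ , p = #-satisfiable (P? ∘ (false ∷_)) 0<# in false ∷ σ , p
... | suc _ =
  let σ , p = #-satisfiable (P? ∘ (true ∷_)) (subst (0 <_) (sym eq) (s≤s z≤n))
  in true ∷ σ , p

#-positive : (P? : Decidable P) → (∀ σ → P σ) → 0 < # P?
#-positive {zero}  P? all with P? []
... | yes _ = ≤-refl
... | no ¬p = contradiction (all []) ¬p
#-positive {suc m} P? all =
  ≤-trans (#-positive (P? ∘ (true ∷_)) (all ∘ (true ∷_))) (m≤m+n _ _)

flip : Fin m → Vec Bool m → Vec Bool m
flip i σ = updateAt σ i not

#-flip : (P? : Decidable P) (i : Fin m) → # (P? ∘ flip i) ≡ # P?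
#-flip P? zero    = +-comm (# (P? ∘ (false ∷_))) _
#-flip P? (suc i) = cong₂ _+_ (#-flip (P? ∘ (true ∷_)) i) (#-flip (P? ∘ (false ∷_)) i)

agree? : (τ : Vec Bool m) (L : List (Fin m)) →
         Decidable (λ σ → All (λ i → lookup σ i ≡ lookup τ i) L)
agree? τ L σ = All.all? (λ i → lookup σ i ≟ᵇ lookup τ i) L

-- Flipping one coordinate of L pairs each agreeing assignment with a
-- disagreeing one, so every coordinate halves the count.
#-agree : (P? : Decidable P) (τ : Vec Bool m) {L : List (Fin m)} → Unique L →
          (∀ {i σ} → i ∈ˡ L → lookup σ i ≡ lookup τ i → P σ → P (flip i σ)) →
          2 ^ length L * # (P? ∩? agree? τ L) ≤ # P?
#-agree P? τ {[]} _ _ =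
  ≤-trans (≤-reflexive (*-identityˡ _)) (#-mono (P? ∩? agree? τ []) P? proj₁)
#-agree {P = P} P? τ {i ∷ L} (i∉L ∷ unique) closed = begin
  2 ^ suc l * # (P? ∩? agree? τ (i ∷ L)) ≡⟨ cong (_* # (P? ∩? agree? τ (i ∷ L))) (*-comm 2 (2 ^ l)) ⟩
  2 ^ l * 2 * # (P? ∩? agree? τ (i ∷ L)) ≡⟨ *-assoc (2 ^ l) 2 _ ⟩
  2 ^ l * (2 * # (P? ∩? agree? τ (i ∷ L))) ≤⟨ *-monoʳ-≤ (2 ^ l) halve ⟩
  2 ^ l * # A?                           ≤⟨ #-agree P? τ unique (closed ∘ there) ⟩
  # P? ∎
  where
  open ≤-Reasoning
  l = length L
  A? = P? ∩? agree? τ L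
  E? : Decidable (λ σ → lookup σ i ≡ lookup τ i)
  E? σ = lookup σ i ≟ᵇ lookup τ i
  flipped : ∀ {σ} → ((P ∩ λ σ → All (λ j → lookup σ j ≡ lookup τ j) L)
                      ∩ (λ σ → lookup σ i ≡ lookup τ i)) σ →
            ((P ∩ λ σ → All (λ j → lookup σ j ≡ lookup τ j) L)
                      ∩ (λ σ → lookup σ i ≢ lookup τ i)) (flip i σ)
  flipped {σ} ((p , agree) , eq) =
    ( closed (here refl) eq p
    , All.zipWith (λ { {j} (i≢j , eq′) →
        trans (lookup∘updateAt′ j i (i≢j ∘ sym) σ) eq′ }) (i∉L , agree)) ,
    λ eq′ → not-¬ (sym eq) (trans (sym eq′) (lookup∘updateAt i σ))
  halve : 2 * # (P? ∩? agree? τ (i ∷ L)) ≤ # A?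
  halve = begin
    2 * # (P? ∩? agree? τ (i ∷ L))
      ≤⟨ *-monoʳ-≤ 2 (#-mono (P? ∩? agree? τ (i ∷ L)) (A? ∩? E?)
           λ { (p , eq ∷ agree) → (p , agree) , eq }) ⟩
    2 * # (A? ∩? E?)
      ≡⟨ cong (# (A? ∩? E?) +_) (+-identityʳ _) ⟩
    # (A? ∩? E?) + # (A? ∩? E?)
      ≤⟨ +-monoʳ-≤ (# (A? ∩? E?)) (#-mono (A? ∩? E?) ((A? ∩? ∁? E?) ∘ flip i) flipped) ⟩
    # (A? ∩? E?) + # ((A? ∩? ∁? E?) ∘ flip i)
      ≡⟨ cong (# (A? ∩? E?) +_) (#-flip (A? ∩? ∁? E?) i) ⟩
    # (A? ∩? E?) + # (A? ∩? ∁? E?)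
      ≡⟨ #-split A? E? ⟨
    # A? ∎

-- Sizes of lists, subsets and unions

++⁻ˡ-unique : {A : Set} (xs : List A) {ys : List A} → Unique (xs ++ ys) → Unique xs
++⁻ˡ-unique []       _                 = []
++⁻ˡ-unique (_ ∷ xs) (x∉ ∷ unique) = ++⁻ˡ xs x∉ ∷ ++⁻ˡ-unique xs unique

length≤∣p∣ : {p : Subset n} {xs : List (Fin n)} → Unique xs → All (_∈ p) xs → length xs ≤ ∣ p ∣
length≤∣p∣ [] [] = z≤n
length≤∣p∣ (x∉xs ∷ unique) (x∈p ∷ xs⊆p) = ≤-trans
  (s≤s (length≤∣p∣ unique (All.zipWith (λ (x≢y , y∈p) → x∈p∧x≢y⇒x∈p-y y∈p (x≢y ∘ sym)) (x∉xs , xs⊆p))))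
  (x∈p⇒∣p-x∣<∣p∣ x∈p)

∣p∪q∣≤∣p∣+∣q∣ : (p q : Subset n) → ∣ p ∪ q ∣ ≤ ∣ p ∣ + ∣ q ∣
∣p∪q∣≤∣p∣+∣q∣ []          []          = z≤n
∣p∪q∣≤∣p∣+∣q∣ (false ∷ p) (false ∷ q) = ∣p∪q∣≤∣p∣+∣q∣ p q
∣p∪q∣≤∣p∣+∣q∣ (false ∷ p) (true ∷ q)  =
  ≤-trans (s≤s (∣p∪q∣≤∣p∣+∣q∣ p q)) (≤-reflexive (sym (+-suc ∣ p ∣ ∣ q ∣)))
∣p∪q∣≤∣p∣+∣q∣ (true ∷ p)  (y ∷ q)     =
  s≤s (≤-trans (∣p∪q∣≤∣p∣+∣q∣ p q) (+-monoʳ-≤ ∣ p ∣ (∣p∣≤∣x∷p∣ y q)))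

∣⋃∣≤ : {A : Set} (f : A → Subset n) {d : ℕ} {xs : List A} →
       All (λ x → ∣ f x ∣ ≤ d) xs → ∣ ⋃ (map f xs) ∣ ≤ length xs * d
∣⋃∣≤ {n} f [] = ≤-reflexive (∣⊥∣≡0 n)
∣⋃∣≤ f {xs = x ∷ xs} (fx≤d ∷ rest) =
  ≤-trans (∣p∪q∣≤∣p∣+∣q∣ (f x) (⋃ (map f xs))) (+-mono-≤ fx≤d (∣⋃∣≤ f rest))

∈⋃⁺ : {A : Set} (f : A → Subset n) {y : Fin n} {x : A} {xs : List A} →
      x ∈ˡ xs → y ∈ f x → y ∈ ⋃ (map f xs)
∈⋃⁺ f {xs = _ ∷ xs} (here refl) y∈fx = p⊆p∪q (⋃ (map f xs)) y∈fx
∈⋃⁺ f {xs = x ∷ _}  (there x∈xs) y∈fx = q⊆p∪q (f x) _ (∈⋃⁺ f x∈xs y∈fx)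

-- The lopsided local lemma

-- The usual weight x of the local lemma is 1/(q + 1), events have probability at
-- most 1/K, and denominators are cleared in the condition K⁻¹ ≤ x (1 - x)ᵈ.
module LocalLemma
  {m N : ℕ} {Bad : Fin N → Pred (Vec Bool m) 0ℓ} (Bad? : ∀ c → Decidable (Bad c))
  (d K q : ℕ) .{{_ : NonZero q}} (weight : suc q * suc q ^ d ≤ K * q ^ d)
  where

  Good? : (S : List (Fin N)) → Decidable (λ σ → All (λ c → ¬ Bad c σ) S)
  Good? S σ = All.all? (λ c → ¬? (Bad? c σ)) S

  -- A one-sided substitute for mutual independence: conditioning on avoiding events outside `U`
  -- must respect the bound `1/K` on `Bad c`. The product form also covers conditions of count zero.
  Lopsided : Set
  Lopsided = ∀ c → ∃ λ U → ∣ U ∣ ≤ d ×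
    (∀ R → All (_∉ U) R → K * # (Bad? c ∩? Good? R) ≤ # (Good? R))

  module _ (lopsided : Lopsided) where
    open ≤-Reasoning

    -- Split `S` into the part `T` inside the conflict set of `c` and the rest `R`. Dropping `T`
    -- from the numerator lets the lopsided bound apply; `extend` restores `T` in the denominator at
    -- a cost of at most `(suc q / q) ^ d`, which `weight` pays for. The recursion descends on `k`:
    -- `extend (suc k)` calls `avoid k`, which calls `extend k`.
    avoid : ∀ k {S} → Unique S → length S ≤ k → ∀ c →
            suc q * # (Bad? c ∩? Good? S) ≤ # (Good? S)

    -- Chain rule: by `avoid`, each event of `T` in turn has conditional probability at most
    -- `1/(q + 1)`, so avoiding it too keeps a fraction of at least `q/(q + 1)`.
    extend : ∀ k T R → Unique (T ++ R) → length (T ++ R) ≤ k →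
             q ^ length T * # (Good? R) ≤ suc q ^ length T * # (Good? (T ++ R))
    extend k [] R _ _ = ≤-refl
    extend (suc k) (t ∷ T) R (_ ∷ unique) (s≤s len) = begin
      q * q ^ l * # (Good? R)            ≡⟨ *-assoc q (q ^ l) _ ⟩
      q * (q ^ l * # (Good? R))          ≤⟨ *-monoʳ-≤ q (extend k T R unique len) ⟩
      q * (suc q ^ l * # (Good? TR))     ≡⟨ swap q (suc q ^ l) _ ⟩
      suc q ^ l * (q * # (Good? TR))     ≤⟨ *-monoʳ-≤ (suc q ^ l) step ⟩
      suc q ^ l * (suc q * # (Good? (t ∷ TR))) ≡⟨ swap (suc q ^ l) (suc q) _ ⟩
      suc q * (suc q ^ l * # (Good? (t ∷ TR))) ≡⟨ *-assoc (suc q) (suc q ^ l) _ ⟨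
      suc q * suc q ^ l * # (Good? (t ∷ TR)) ∎
      where
      l = length T
      TR = T ++ R
      swap : ∀ a b c → a * (b * c) ≡ b * (a * c)
      swap = solve-∀
      g = # (Good? TR)
      bad = # (Bad? t ∩? Good? TR)
      split : g ≤ bad + # (Good? (t ∷ TR))
      split = begin
        g ≡⟨ #-split (Good? TR) (Bad? t) ⟩
        # (Good? TR ∩? Bad? t) + # (Good? TR ∩? ∁? (Bad? t))
          ≤⟨ +-mono-≤
              (#-mono (Good? TR ∩? Bad? t) (Bad? t ∩? Good? TR) (λ (g , b) → b , g))
              (#-mono (Good? TR ∩? ∁? (Bad? t)) (Good? (t ∷ TR)) (λ (g , ¬b) → ¬b ∷ g)) ⟩
        bad + # (Good? (t ∷ TR)) ∎
      step : q * g ≤ suc q * # (Good? (t ∷ TR))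
      -- `suc q * g` unfolds to `g + q * g`, so cancelling `g` replaces a subtraction.
      step = +-cancelˡ-≤ g _ _ (begin
        suc q * g                                       ≤⟨ *-monoʳ-≤ (suc q) split ⟩
        suc q * (bad + # (Good? (t ∷ TR)))              ≡⟨ *-distribˡ-+ (suc q) bad _ ⟩
        suc q * bad + suc q * # (Good? (t ∷ TR))        ≤⟨ +-monoˡ-≤ _ (avoid k unique len t) ⟩
        g + suc q * # (Good? (t ∷ TR))                  ∎)

    avoid k {S} unique len c = *-cancelˡ-≤ (suc q ^ d) {{m^n≢0 (suc q) d}} (begin
      suc q ^ d * (suc q * x)         ≡⟨ *-assoc (suc q ^ d) (suc q) x ⟨
      suc q ^ d * suc q * x           ≡⟨ cong (_* x) (*-comm (suc q ^ d) (suc q)) ⟩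
      suc q * suc q ^ d * x           ≤⟨ *-monoˡ-≤ x weight ⟩
      K * q ^ d * x                   ≤⟨ *-monoʳ-≤ (K * q ^ d)
                                          (#-mono (Bad? c ∩? Good? S) (Bad? c ∩? Good? R)
                                            λ (b , g) → b , ++⁻ʳ T (All-resp-↭ S↭ g)) ⟩
      K * q ^ d * # (Bad? c ∩? Good? R) ≡⟨ cong (_* # (Bad? c ∩? Good? R)) (*-comm K (q ^ d)) ⟩
      q ^ d * K * # (Bad? c ∩? Good? R) ≡⟨ *-assoc (q ^ d) K _ ⟩
      q ^ d * (K * # (Bad? c ∩? Good? R)) ≤⟨ *-monoʳ-≤ (q ^ d) (proj₂ (proj₂ (lopsided c)) R (proj₂ parts)) ⟩
      -- `T` may have fewer than `d` events; the `d ∸ l` spare factors `q` are enlarged to `suc q`.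
      q ^ d * # (Good? R)             ≡⟨ cong (λ e → q ^ e * # (Good? R)) (m∸n+n≡m T≤d) ⟨
      q ^ (d ∸ l + l) * # (Good? R)   ≡⟨ cong (_* # (Good? R)) (^-distribˡ-+-* q (d ∸ l) l) ⟩
      q ^ (d ∸ l) * q ^ l * # (Good? R) ≡⟨ *-assoc (q ^ (d ∸ l)) (q ^ l) _ ⟩
      q ^ (d ∸ l) * (q ^ l * # (Good? R))
        ≤⟨ *-mono-≤ (^-monoˡ-≤ (d ∸ l) (n≤1+n q))
                    (extend k T R unique′ (≤-trans (≤-reflexive (sym (↭-length S↭))) len)) ⟩
      suc q ^ (d ∸ l) * (suc q ^ l * # (Good? (T ++ R)))
        ≡⟨ *-assoc (suc q ^ (d ∸ l)) (suc q ^ l) _ ⟨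
      suc q ^ (d ∸ l) * suc q ^ l * # (Good? (T ++ R))
        ≡⟨ cong (_* # (Good? (T ++ R))) (^-distribˡ-+-* (suc q) (d ∸ l) l) ⟨
      suc q ^ (d ∸ l + l) * # (Good? (T ++ R))
        ≡⟨ cong (λ e → suc q ^ e * # (Good? (T ++ R))) (m∸n+n≡m T≤d) ⟩
      suc q ^ d * # (Good? (T ++ R))
        ≤⟨ *-monoʳ-≤ (suc q ^ d) (#-mono (Good? (T ++ R)) (Good? S) (All-resp-↭ (↭-sym S↭))) ⟩
      suc q ^ d * # (Good? S) ∎)
      where
      x = # (Bad? c ∩? Good? S)
      U = proj₁ (lopsided c)
      T = proj₁ (partition (_∈? U) S)
      R = proj₂ (partition (_∈? U) S)
      parts = partition-All (_∈? U) S
      l = length T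
      S↭ : S ↭ T ++ R
      S↭ = ↭ₛ⇒↭ (↭ₛ.partition-↭ (setoid (Fin N)) (_∈? U) S)
      unique′ : Unique (T ++ R)
      unique′ = ↭ₛ.Unique-resp-↭ (setoid (Fin N)) (↭⇒↭ₛ S↭) unique
      T≤d : l ≤ d
      T≤d = ≤-trans (length≤∣p∣ (++⁻ˡ-unique T unique′) (proj₁ parts)) (proj₁ (proj₂ (lopsided c)))

    -- Starting from the full cube, avoiding the `N` events one by one keeps at least the fraction
    -- `(q / suc q) ^ N`, which is positive.
    avoidable : ∃ λ σ → ∀ c → ¬ Bad c σ
    avoidable =
      let σ , good = #-satisfiable (Good? S) positive
      in  σ , λ c → All.lookup good (∈-++⁺ˡ (∈-allFin c))
      where
      S = allFin N ++ []
      l = length (allFin N)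
      unique : Unique S
      unique = subst Unique (sym (++-identityʳ (allFin N))) (Unique.allFin⁺ N)
      positive : 0 < # (Good? S)
      positive = *-cancelˡ-< (suc q ^ l) 0 _ (begin-strict
        suc q ^ l * 0               ≡⟨ *-zeroʳ (suc q ^ l) ⟩
        0                           <⟨ *-mono-≤ (m^n>0 q l) (#-positive (Good? []) (λ _ → [])) ⟩
        q ^ l * # (Good? [])        ≤⟨ extend (length S) (allFin N) [] unique ≤-refl ⟩
        suc q ^ l * # (Good? S)     ∎)

-- The numerical condition on the weight

-- This is `1 - j x ≤ (1 - x) ^ j` at `x = 1/(q + 1)`, multiplied by `suc q ^ suc j` and with the
-- negative term moved across.
bernoulli : ∀ q j → suc q * suc q ^ j ≤ suc q * q ^ j + j * suc q ^ j
bernoulli q zero    = m≤m+n _ _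
bernoulli q (suc j) = begin
  suc q * (suc q * suc q ^ j)                            ≤⟨ *-monoʳ-≤ (suc q) (bernoulli q j) ⟩
  suc q * (suc q * q ^ j + j * suc q ^ j)                ≡⟨ expand q (q ^ j) j (suc q ^ j) ⟩
  suc q * q ^ suc j + (suc q * q ^ j + j * suc q ^ suc j)
    ≤⟨ +-monoʳ-≤ (suc q * q ^ suc j) (+-monoˡ-≤ (j * suc q ^ suc j) (*-monoʳ-≤ (suc q) (^-monoˡ-≤ j (n≤1+n q)))) ⟩
  suc q * q ^ suc j + suc j * suc q ^ suc j              ∎
  where
  open ≤-Reasoning
  expand : ∀ q x j y → suc q * (suc q * x + j * y) ≡ suc q * (q * x) + (suc q * x + j * (suc q * y))
  expand = solve-∀

-- Bernoulli's inequality makes x = 1/(2d) a sufficient weight.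
weight-of-large : ∀ d K .{{_ : NonZero d}} → 4 * d ≤ K →
                  ∃ λ q → NonZero q × suc q * suc q ^ d ≤ K * q ^ d
weight-of-large (suc d) K 4d≤K = q , _ , (begin
  suc q * y         ≡⟨ double d y ⟩
  2 * (suc d * y)   ≤⟨ *-monoʳ-≤ 2 (+-cancelʳ-≤ (suc d * y) (suc d * y) (suc q * x) half) ⟩
  2 * (suc q * x)   ≡⟨ quadruple d x ⟩
  4 * suc d * x     ≤⟨ *-monoˡ-≤ x 4d≤K ⟩
  K * x             ∎)
  where
  open ≤-Reasoning
  -- `suc q` is twice the exponent `suc d`.
  q = suc (2 * d)
  x = q ^ suc d
  y = suc q ^ suc d
  double : ∀ d y → suc (suc (2 * d)) * y ≡ 2 * (suc d * y)
  double = solve-∀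
  quadruple : ∀ d x → 2 * (suc (suc (2 * d)) * x) ≡ 4 * suc d * x
  quadruple = solve-∀
  sum : ∀ d y → suc d * y + suc d * y ≡ suc (suc (2 * d)) * y
  sum = solve-∀
  -- After cancellation this says `(q / suc q) ^ suc d ≥ 1/2`.
  half : suc d * y + suc d * y ≤ suc q * x + suc d * y
  half = ≤-trans (≤-reflexive (sum d y)) (bernoulli q (suc d))

-- The start is 8 because `Δ = 7` would ask for `168 ≤ 128`.
4Δ[Δ-1]≤2^Δ : ∀ j → let Δ = 8 + j in 4 * (Δ * (Δ ∸ 1)) ≤ 2 ^ Δ
4Δ[Δ-1]≤2^Δ zero    = toWitness {a? = 224 ≤? 256} tt
4Δ[Δ-1]≤2^Δ (suc j) = begin
  -- The added term is the excess of twice the old left side over the new one.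
  4 * ((8 + suc j) * (7 + suc j))      ≤⟨ m≤m+n _ (4 * ((8 + j) * (5 + j))) ⟩
  4 * ((8 + suc j) * (7 + suc j)) + 4 * ((8 + j) * (5 + j)) ≡⟨ eq j ⟩
  2 * (4 * ((8 + j) * (7 + j)))        ≤⟨ *-monoʳ-≤ 2 (4Δ[Δ-1]≤2^Δ j) ⟩
  2 ^ (8 + suc j)                      ∎
  where
  open ≤-Reasoning
  eq : ∀ j → 4 * ((8 + suc j) * (7 + suc j)) + 4 * ((8 + j) * (5 + j)) ≡
             2 * (4 * ((8 + j) * (7 + j)))
  eq = solve-∀

-- For Δ = 7 the weight 1/(2d) is too crude, and x = 1/(d + 1) is used instead.
weight : ∀ {Δ} → 7 ≤ Δ → let d = Δ * (Δ ∸ 1) in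
         ∃ λ q → NonZero q × suc q * suc q ^ d ≤ 2 ^ Δ * q ^ d
weight {Δ} 7≤Δ with ≤⇒≤‴ 7≤Δ
-- Here `d = 42`, and `43 * (43/42) ^ 42 < 43 e < 117`.
... | ≤‴-refl = 42 , _ , toWitness {a? = 43 * 43 ^ 42 ≤? 128 * 42 ^ 42} tt
... | ≤‴-step 8≤Δ with j , refl ← m≤n⇒∃[o]m+o≡n (≤‴⇒≤ 8≤Δ) =
  let Δ = 8 + j in weight-of-large (Δ * (Δ ∸ 1)) (2 ^ Δ) (4Δ[Δ-1]≤2^Δ j)

-- Selecting an endpoint of every matching edge

module _ (G : Graph n) where
  open Graph G

  ∈-neighbours⁺ : ∀ {v u} → v ~ u → u ∈ neighbours G v
  ∈-neighbours⁺ {v} {u} v~u =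
    lookup⇒[]= u _ (trans (lookup∘tabulate _ u) (dec-true (v ~? u) v~u))

  ∈-neighbours⁻ : ∀ {v u} → u ∈ neighbours G v → v ~ u
  ∈-neighbours⁻ {v} {u} u∈Nv with v ~? u | trans (sym (lookup∘tabulate (λ u → does (v ~? u)) u)) ([]=⇒lookup u∈Nv)
  ... | yes v~u | _ = v~u

  edge-of : ∀ {u v} → u ~ v → ∃ λ e → Incident G u e × (∀ {x} → Incident G x e → x ≡ u ⊎ x ≡ v)
  edge-of {u} {v} u~v with <-cmp u v
  ... | tri≈ _ u≡v _ = contradiction u~v (~-irrefl u≡v)
  ... | tri< u<v _ _ = index uv∈ , inj₁ (cong proj₁ eq) ,
      Sum.map (λ x≡ → trans x≡ (sym (cong proj₁ eq))) (λ x≡ → trans x≡ (sym (cong proj₂ eq)))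
    where
    uv∈ = Equivalence.from (∈-edges G) (u<v , u~v)
    eq = lookup-index uv∈
  ... | tri> _ _ v<u = index vu∈ , inj₂ (cong proj₂ eq) ,
      Sum.swap ∘ Sum.map (λ x≡ → trans x≡ (sym (cong proj₁ eq))) (λ x≡ → trans x≡ (sym (cong proj₂ eq)))
    where
    vu∈ = Equivalence.from (∈-edges G) (v<u , ~-sym u~v)
    eq = lookup-index vu∈

  end : Bool → Edge G → Fin n
  end true  e = proj₁ (List.lookup (edges G) e)
  end false e = proj₂ (List.lookup (edges G) e)

  end~end : ∀ b e → end b e ~ end (not b) e
  end~end true  e = proj₂ (Equivalence.to (∈-edges G) (∈-lookup e))
  end~end false e = ~-sym (end~end true e)

  incident-end : ∀ b e → Incident G (end b e) e
  incident-end true  e = inj₁ refl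
  incident-end false e = inj₂ refl

  -- A selection orients every edge of the graph, which makes the sample space a plain Boolean cube;
  -- the bad events read only the coordinates in `M`.
  pick drop : Vec Bool (length (edges G)) → Edge G → Fin n
  pick σ e = end (lookup σ e) e
  drop σ e = end (not (lookup σ e)) e

  pick~drop : ∀ σ e → pick σ e ~ drop σ e
  pick~drop σ e = end~end (lookup σ e) e

  incident⇒pick⊎drop : ∀ σ {v e} → Incident G v e → v ≡ pick σ e ⊎ v ≡ drop σ e
  incident⇒pick⊎drop σ {e = e} v∈e with lookup σ e
  ... | true  = v∈e
  ... | false = Sum.swap v∈e

  Covered : EdgeSet G → Fin n → Set
  Covered M v = ∃ λ e → e ∈ M × Incident G v e

  covered? : ∀ M → Decidable (Covered M)
  covered? M v = any? λ e → (e ∈? M) ×-dec incident? G v e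

  -- An edge with both ends uncovered could be added to the matching.
  maximal⇒edge-covered : ∀ {M} → MaximalMatching G M → ∀ {u v} → u ~ v →
                         ¬ Covered M u → Covered M v
  maximal⇒edge-covered {M} (matching , maximal) {u} {v} u~v ¬covered-u
    with covered? M v | edge-of u~v
  ... | yes covered-v | _ = covered-v
  ... | no ¬covered-v | e , u∈e , ends =
    contradiction matching′ (maximal e (λ e∈M → ¬covered-u (e , e∈M , u∈e)))
    where
    separate : ∀ {f x} → f ∈ M → Incident G x f → ¬ Incident G x e
    separate f∈M x∈f x∈e with ends x∈e
    ... | inj₁ refl = ¬covered-u (_ , f∈M , x∈f)
    ... | inj₂ refl = ¬covered-v (_ , f∈M , x∈f)
    matching′ : Matching G (M ∪ ⁅ e ⁆)
    matching′ f g f∈ g∈ f≢g (x , x∈f , x∈g)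
      with x∈p∪q⁻ M ⁅ e ⁆ f∈ | x∈p∪q⁻ M ⁅ e ⁆ g∈
    ... | inj₁ f∈M | inj₁ g∈M = matching f g f∈M g∈M f≢g (x , x∈f , x∈g)
    ... | inj₁ f∈M | inj₂ g∈e with refl ← x∈⁅y⁆⇒x≡y e g∈e = separate f∈M x∈f x∈g
    ... | inj₂ f∈e | inj₁ g∈M with refl ← x∈⁅y⁆⇒x≡y e f∈e = separate g∈M x∈g x∈f
    ... | inj₂ f∈e | inj₂ g∈e =
      f≢g (trans (x∈⁅y⁆⇒x≡y e f∈e) (sym (x∈⁅y⁆⇒x≡y e g∈e)))

  module _ {M : EdgeSet G} (maximal : MaximalMatching G M) where

    -- The bad event of `v`. It excludes covered vertices, since such a vertex is either picked
    -- itself or adjacent to the picked end of its matching edge.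
    Undominated : Fin n → Pred (Vec Bool (length (edges G))) 0ℓ
    Undominated v σ = ¬ Covered M v × (∀ e → e ∈ M → ¬ v ~ pick σ e)

    undominated? : ∀ v → Decidable (Undominated v)
    undominated? v σ = ¬? (covered? M v) ×-dec
      all? λ e → (e ∈? M) →-dec ¬? (v ~? pick σ e)

    picked : Vec Bool (length (edges G)) → Subset n
    picked σ = ⋃ (map (⁅_⁆ ∘ pick σ) (filter (_∈? M) (allFin _)))

    ∣picked∣≤∣M∣ : ∀ σ → ∣ picked σ ∣ ≤ ∣ M ∣
    ∣picked∣≤∣M∣ σ = begin
      ∣ picked σ ∣      ≤⟨ ∣⋃∣≤ (⁅_⁆ ∘ pick σ) {xs = es} (All.tabulate λ {e} _ → ≤-reflexive (∣⁅x⁆∣≡1 (pick σ e))) ⟩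
      length es * 1     ≡⟨ *-identityʳ _ ⟩
      length es         ≤⟨ length≤∣p∣ (Unique.filter⁺ (_∈? M) (Unique.allFin⁺ _)) (all-filter (_∈? M) (allFin _)) ⟩
      ∣ M ∣             ∎
      where
      open ≤-Reasoning
      es = filter (_∈? M) (allFin _)

    pick∈picked : ∀ σ {e} → e ∈ M → pick σ e ∈ picked σ
    pick∈picked σ {e} e∈M =
      ∈⋃⁺ (⁅_⁆ ∘ pick σ) (∈-filter⁺ (_∈? M) (∈-allFin e) e∈M) (x∈⁅x⁆ _)

    picked-dominating : ∀ σ → (∀ v → ¬ Undominated v σ) → Dominating G (picked σ)
    picked-dominating σ none v v∉D
      with any? (λ e → (e ∈? M) ×-dec (v ~? pick σ e)) | covered? M v
    ... | yes (e , e∈M , v~pick) | _ = pick σ e , pick∈picked σ e∈M , v~pick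
    ... | no ∄e | no ¬covered =
      contradiction (¬covered , λ e e∈M v~pick → ∄e (e , e∈M , v~pick)) (none v)
    ... | no ∄e | yes (e , e∈M , v∈e) with incident⇒pick⊎drop σ v∈e
    ...   | inj₂ refl = contradiction (e , e∈M , ~-sym (pick~drop σ e)) ∄e
    ...   | inj₁ refl = contradiction (pick∈picked σ e∈M) v∉D

    -- Conflicts between undominated vertices

    module _ {Δ : ℕ} (regular : Regular G Δ) (q : ℕ) .{{_ : NonZero q}}
             (weighted : suc q * suc q ^ (Δ * (Δ ∸ 1)) ≤ 2 ^ Δ * q ^ (Δ * (Δ ∸ 1))) where

      open LocalLemma undominated? (Δ * (Δ ∸ 1)) (2 ^ Δ) q weighted

      -- A selection τ leaving v undominated fixes the orientation of the
      -- matching edges at v: v is adjacent only to their dropped ends.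
      lopsided : Lopsided
      lopsided v with anySubset? (undominated? v)
      -- An impossible event has count zero and conflicts with nothing.
      ... | no ∄τ = ⊥ , ≤-trans (≤-reflexive (∣⊥∣≡0 n)) z≤n , λ R _ →
        ≤-trans (*-monoʳ-≤ (2 ^ Δ) (≮⇒≥ λ 0<# →
                  let τ , bad , _ = #-satisfiable (undominated? v ∩? Good? R) 0<#
                  in  ∄τ (τ , bad)))
                (≤-trans (≤-reflexive (*-zeroʳ (2 ^ Δ))) z≤n)
      ... | yes (τ , ¬covered , v≁pick) = U , ∣U∣≤ , bound
        where
        open ≤-Reasoning
        at? : Decidable (λ e → e ∈ M × v ~ drop τ e)
        at? e = (e ∈? M) ×-dec (v ~? drop τ e)
        es L : List (Edge G)
        es = filter at? (allFin _)
        -- Truncation turns the bound `Δ≤∣es∣` into an exact length, which serves both the factor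
        -- `2 ^ Δ` and the upper bound on `U`.
        L = take Δ es
        L-unique : Unique L
        L-unique = Unique.take⁺ Δ (Unique.filter⁺ at? (Unique.allFin⁺ _))
        L-at : All (λ e → e ∈ M × v ~ drop τ e) L
        L-at = take⁺ Δ (all-filter at? (allFin _))
        -- Since `v` is uncovered, maximality covers each neighbour of `v`; it is not picked by `τ`,
        -- so it is a dropped end.
        neighbours⊆ : neighbours G v ⊆ ⋃ (map (⁅_⁆ ∘ drop τ) es)
        neighbours⊆ u∈Nv with v~u ← ∈-neighbours⁻ u∈Nv
          with e , e∈M , u∈e ← maximal⇒edge-covered maximal v~u ¬covered
          with incident⇒pick⊎drop τ u∈e
        ... | inj₁ refl = contradiction v~u (v≁pick e e∈M)
        ... | inj₂ refl = ∈⋃⁺ (⁅_⁆ ∘ drop τ) (∈-filter⁺ at? (∈-allFin e) (e∈M , v~u)) (x∈⁅x⁆ _)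
        Δ≤∣es∣ : Δ ≤ length es
        Δ≤∣es∣ = begin
          Δ                                  ≡⟨ regular v ⟨
          ∣ neighbours G v ∣                 ≤⟨ p⊆q⇒∣p∣≤∣q∣ neighbours⊆ ⟩
          ∣ ⋃ (map (⁅_⁆ ∘ drop τ) es) ∣      ≤⟨ ∣⋃∣≤ (⁅_⁆ ∘ drop τ) {xs = es} (All.tabulate λ {e} _ → ≤-reflexive (∣⁅x⁆∣≡1 (drop τ e))) ⟩
          length es * 1                      ≡⟨ *-identityʳ _ ⟩
          length es                          ∎
        ∣L∣≡Δ : length L ≡ Δ
        ∣L∣≡Δ = trans (length-take Δ es) (m≤n⇒m⊓n≡m Δ≤∣es∣)
        -- Flipping `e` away from `τ` withdraws `pick τ e`, so only neighbours of that vertex can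
        -- become undominated. One of them is `drop τ e`, which is covered and hence never bad; this
        -- leaves `Δ ∸ 1`.
        rivals : Edge G → Subset n
        rivals e = neighbours G (pick τ e) - drop τ e
        ∣rivals∣≤ : ∀ e → ∣ rivals e ∣ ≤ Δ ∸ 1
        ∣rivals∣≤ e = ∸-monoˡ-≤ 1 (≤-trans (x∈p⇒∣p-x∣<∣p∣ (∈-neighbours⁺ (pick~drop τ e)))
                                           (≤-reflexive (regular (pick τ e))))
        U = ⋃ (map rivals L)
        ∣U∣≤ : ∣ U ∣ ≤ Δ * (Δ ∸ 1)
        ∣U∣≤ = begin
          ∣ U ∣                 ≤⟨ ∣⋃∣≤ rivals {xs = L} (All.tabulate λ {e} _ → ∣rivals∣≤ e) ⟩
          length L * (Δ ∸ 1)    ≡⟨ cong (_* (Δ ∸ 1)) ∣L∣≡Δ ⟩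
          Δ * (Δ ∸ 1)           ∎
        -- A selection that differs from `τ` at an edge of `L` picks its `τ`-dropped end, which is
        -- adjacent to `v`.
        agree : ∀ {σ} → Undominated v σ → All (λ e → lookup σ e ≡ lookup τ e) L
        agree {σ} (_ , v≁pickσ) = All.map (λ {e} (e∈M , v~drop) →
          decidable-stable (lookup σ e ≟ᵇ lookup τ e) λ σe≢τe →
            v≁pickσ e e∈M (subst (λ b → v ~ end b e) (sym (¬-not σe≢τe)) v~drop)) L-at
        still-undominated : ∀ {i σ r} → i ∈ˡ L → lookup σ i ≡ lookup τ i → r ∉ U →
                            Undominated r (flip i σ) → Undominated r σ
        still-undominated {i} {σ} {r} i∈L σi≡τi r∉U (¬covered-r , r≁flipped) =
          ¬covered-r , r≁pick
          where
          i∈M = proj₁ (All.lookup L-at i∈L)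
          r≁pick : ∀ e → e ∈ M → ¬ r ~ pick σ e
          r≁pick e e∈M r~pick with e ≟ i
          ... | no e≢i = r≁flipped e e∈M
            (subst (λ b → r ~ end b e) (sym (lookup∘updateAt′ e i e≢i σ)) r~pick)
          ... | yes refl = r∉U (∈⋃⁺ rivals i∈L (x∈p∧x≢y⇒x∈p-y
            (∈-neighbours⁺ (~-sym (subst (λ b → r ~ end b i) σi≡τi r~pick)))
            λ r≡drop → ¬covered-r (i , i∈M , subst (λ x → Incident G x i) (sym r≡drop)
                                               (incident-end (not (lookup τ i)) i))))
        -- By `still-undominated`, flips away from `τ` on `L` create no bad event in `R`, so each of
        -- the `Δ` coordinates in `L` halves the count.
        bound : ∀ R → All (_∉ U) R → 2 ^ Δ * # (undominated? v ∩? Good? R) ≤ # (Good? R)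
        bound R R∉U = begin
          2 ^ Δ * # (undominated? v ∩? Good? R)
            ≤⟨ *-monoʳ-≤ (2 ^ Δ) (#-mono (undominated? v ∩? Good? R) (Good? R ∩? agree? τ L)
                 λ {σ} (bad , good) → good , agree {σ} bad) ⟩
          2 ^ Δ * # (Good? R ∩? agree? τ L)
            ≡⟨ cong (λ l → 2 ^ l * # (Good? R ∩? agree? τ L)) ∣L∣≡Δ ⟨
          2 ^ length L * # (Good? R ∩? agree? τ L)
            ≤⟨ #-agree (Good? R) τ L-unique (λ {_} {σ} i∈L σi≡τi good →
                 All.zipWith (λ (r∉U , ¬bad) → ¬bad ∘ still-undominated {σ = σ} i∈L σi≡τi r∉U) (R∉U , good)) ⟩
          # (Good? R) ∎

      dominating-selection : ∃ λ S → Dominating G S × ∣ S ∣ ≤ ∣ M ∣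
      dominating-selection = let σ , none = avoidable lopsided in
        picked σ , picked-dominating σ none , ∣picked∣≤∣M∣ σ

theorem1 : (Δ : ℕ) → 7 ≤ Δ → (n : ℕ) (G : Graph n) → Regular G Δ → γ G ≤ γₑ G
theorem1 Δ 7≤Δ n G regular =
  let M , maximal , ∣M∣≡γₑ = attained (proj₂ (edgeDominationNumber G))
      q , q≢0 , weighted = weight 7≤Δ
      S , dominating , ∣S∣≤∣M∣ = dominating-selection G maximal regular q {{q≢0}} weighted
  in  ≤-trans (lowerBound (proj₂ (dominationNumber G)) S dominating)
              (≤-trans ∣S∣≤∣M∣ (≤-reflexive ∣M∣≡γₑ))
  where open IsMinimumSize
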